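{- Let $(X,\kappa)$ be a digital image. Then $(X,\kappa)$ has the fixed point property (FPP) if and only if $|X|=1$.
   Context: A digital image is a pair $(X,\kappa)$ where $\emptyset\neq X\subset\mathbf{Z}^n$ for some positive integer $n$ and $\kappa$ is an adjacency relation on $X$ (a symmetric, irreflexive relation, so that $(X,\kappa)$ is an undirected simple graph with vertex set $X$). A subset $A\subset X$ is $\kappa$-connected if for every two distinct points $x,y\in A$ there are $x=x_0,x_1,\ldots,x_c=y$ in $A$ with $x_i,x_{i+1}$ $\kappa$-adjacent for all $0\le i<c$. A function $f:(X,\kappa)\to(Y,\lambda)$ between digital images is $(\kappa,\lambda)$-continuous if $f(A)$ is $\lambda$-connected for every $\kappa$-connected $A\subset X$; equivalently, whenever $x_0,x_1\in X$ are $\kappa$-adjacent, $f(x_0)$ and $f(x_1)$ are equal or $\lambda$-adjacent. A fixed point of $f:X\to X$ is a point $x\in X$ with $f(x)=x$. The digital image $(X,\kappa)$ has the fixed point property (FPP) if every $(\kappa,\kappa)$-continuous function $f:X\to X$ has a fixed point. $|X|$ denotes the number of points of $X$. -}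

module Defs where

open import Data.Fin.Base using (Fin; zero; suc; inject₁; fromℕ)
open import Data.Integer.Base using (ℤ)
open import Data.Nat.Base using (ℕ; suc; NonZero)
open import Data.Product.Base using (Σ-syntax; ∃-syntax; _×_)
open import Data.Refinement.Base using (Refinement-syntax)
open import Data.Vec.Base using (Vec)
open import Function.Bundles using (_↔_)
open import Level using (0ℓ)
open import Relation.Binary.Core using (Rel)
open import Relation.Binary.Definitions using (Symmetric; Irreflexive)
open import Relation.Binary.PropositionalEquality.Core using (_≡_; _≢_)
open import Relation.Unary using (Pred; _∈_)

-- X is an arbitrary, possibly infinite, subset of ℤⁿ.  Membership proofs are
-- irrelevant in Point, so two points are equal as soon as their coordinates are.
record DigitalImage : Set₁ where
  field
    n          : ℕ
    ⦃ n≢0 ⦄    : NonZero n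
    X          : Pred (Vec ℤ n) 0ℓ

  Point : Set
  Point = [ p ∈ Vec ℤ n ∣ X p ]

  field
    nonempty   : Point
    κ          : Rel Point 0ℓ
    κ-sym      : Symmetric κ
    κ-irrefl   : Irreflexive _≡_ κ

open DigitalImage public using (Point)

Path : (𝑿 : DigitalImage) → Pred (Point 𝑿) 0ℓ → Rel (Point 𝑿) 0ℓ
Path 𝑿 A x y =
  ∃[ c ] Σ[ p ∈ (Fin (suc c) → Point 𝑿) ]
    p zero ≡ x × p (fromℕ c) ≡ y ×
    (∀ i → p i ∈ A) ×
    (∀ (i : Fin c) → DigitalImage.κ 𝑿 (p (inject₁ i)) (p (suc i)))

Connected : (𝑿 : DigitalImage) → Pred (Point 𝑿) 0ℓ → Set
Connected 𝑿 A = ∀ x y → x ∈ A → y ∈ A → x ≢ y → Path 𝑿 A x y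

image : ∀ {S T : Set} → (S → T) → Pred S 0ℓ → Pred T 0ℓ
image f A y = ∃[ x ] (x ∈ A × f x ≡ y)

Continuous : (𝑿 𝒀 : DigitalImage) → (Point 𝑿 → Point 𝒀) → Set₁
Continuous 𝑿 𝒀 f = ∀ A → Connected 𝑿 A → Connected 𝒀 (image f A)

FixedPointProperty : DigitalImage → Set₁
FixedPointProperty 𝑿 =
  ∀ (f : Point 𝑿 → Point 𝑿) → Continuous 𝑿 𝑿 f → ∃[ x ] f x ≡ x

HasCardinality : DigitalImage → ℕ → Set
HasCardinality 𝑿 k = Point 𝑿 ↔ Fin k

{-# OPTIONS --safe #-}
-- For x ≢ y, the map sending x to y and every other point to x has no fixed
-- point.  If x and y are adjacent it is continuous, because its values lie in
-- {x , y}.  So the fixed point property rules out adjacent points; but then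
-- connected sets have at most one point, every map is continuous, and the same
-- map shows that distinct points cannot exist either.
module Submission where

open import Defs
open import Data.Fin.Base using (Fin; zero; suc)
import Data.Integer.Properties as ℤ
open import Data.Nat.Base using (zero; suc)
open import Data.Product.Base using (_,_)
import Data.Refinement.Properties as Refinement
open import Data.Sum.Base using (_⊎_; inj₁; inj₂)
open import Data.Vec.Properties using (≡-dec)
open import Function.Bundles using (_⇔_; mk⇔; mk↔ₛ′; module Inverse)
open import Level using (0ℓ)
open import Relation.Binary.Definitions using (DecidableEquality)
open import Relation.Binary.PropositionalEquality
  using (_≡_; _≢_; refl; sym; trans; cong)
open import Relation.Nullary using (¬_; yes; no; contradiction)
open import Relation.Nullary.Decidable using (decidable-stable)
open import Relation.Unary using (Pred; _∈_)

module _ (𝑿 : DigitalImage) where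
  open DigitalImage 𝑿 using (κ; κ-sym; κ-irrefl; nonempty)

  infix 4 _≟_
  -- Membership proofs are irrelevant, so comparing coordinates suffices, whatever the predicate `X`
  -- is. The test drives `displace` and permits proofs of equality by contradiction.
  _≟_ : DecidableEquality (Point 𝑿)
  _≟_ = Refinement._≟_ (≡-dec ℤ._≟_)

  edge-path : ∀ A {x y} → x ∈ A → y ∈ A → κ x y → Path 𝑿 A x y
  edge-path A {x} {y} x∈A y∈A xκy = 1 , p , refl , refl , p∈A , λ { zero → xκy }
    where
    p : Fin 2 → Point 𝑿
    p zero    = x
    p (suc _) = y
    p∈A : ∀ i → p i ∈ A
    p∈A zero    = x∈A
    p∈A (suc _) = y∈A

  -- A path of length zero has equal ends and a longer one begins with an edge, so nothing can join
  -- distinct points of `A`.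
  edgeless⇒connected-trivial : (∀ x y → ¬ κ x y) →
    ∀ A → Connected 𝑿 A → ∀ {x y} → x ∈ A → y ∈ A → x ≡ y
  edgeless⇒connected-trivial edgeless A conn {x} {y} x∈A y∈A =
    decidable-stable (x ≟ y) λ x≢y → no-path {A} x≢y (conn x y x∈A y∈A x≢y)
    where
    no-path : ∀ {A : Pred (Point 𝑿) 0ℓ} {x y} → x ≢ y → ¬ Path 𝑿 A x y
    no-path x≢y (zero  , p , p₀≡x , p₀≡y , _) = x≢y (trans (sym p₀≡x) p₀≡y)
    no-path x≢y (suc c , p , _ , _ , _ , adj) = edgeless _ _ (adj zero)

  edgeless⇒continuous : (∀ x y → ¬ κ x y) → ∀ f → Continuous 𝑿 𝑿 f
  edgeless⇒continuous edgeless f A conn _ _ (a , a∈A , refl) (b , b∈A , refl) fa≢fb =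
    contradiction (cong f (edgeless⇒connected-trivial edgeless A conn a∈A b∈A)) fa≢fb

  -- Distinct image points must be `x` and `y` in some order, so the edge between them is already a
  -- path inside the image.
  two-valued⇒continuous : ∀ {x y} → κ x y →
    ∀ f → (∀ z → f z ≡ x ⊎ f z ≡ y) → Continuous 𝑿 𝑿 f
  two-valued⇒continuous {x} {y} xκy f values A _ u v
    u∈fA@(a , _ , refl) v∈fA@(b , _ , refl) u≢v =
    edge-path (image f A) u∈fA v∈fA (adjacent (values a) (values b) u≢v)
    where
    -- Generalising `f a` and `f b` to variables lets every equation be matched with `refl`.
    adjacent : ∀ {u v} → u ≡ x ⊎ u ≡ y → v ≡ x ⊎ v ≡ y → u ≢ v → κ u v
    adjacent (inj₁ refl) (inj₁ refl) u≢v = contradiction refl u≢v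
    adjacent (inj₁ refl) (inj₂ refl) _   = xκy
    adjacent (inj₂ refl) (inj₁ refl) _   = κ-sym xκy
    adjacent (inj₂ refl) (inj₂ refl) u≢v = contradiction refl u≢v

  displace : Point 𝑿 → Point 𝑿 → Point 𝑿 → Point 𝑿
  displace x y z with z ≟ x
  ... | yes _ = y
  ... | no  _ = x

  displace-values : ∀ x y z → displace x y z ≡ x ⊎ displace x y z ≡ y
  displace-values x y z with z ≟ x
  ... | yes _ = inj₂ refl
  ... | no  _ = inj₁ refl

  -- At `x` the value is `y`, which differs from `x`; at any other `z` the value is `x`, which
  -- differs from `z`.
  displace-fixes-none : ∀ {x y} → x ≢ y → ∀ z → displace x y z ≢ z
  displace-fixes-none {x} x≢y z eq with z ≟ x
  ... | yes z≡x = x≢y (sym (trans eq z≡x))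
  ... | no  z≢x = z≢x (sym eq)

  module _ (fpp : FixedPointProperty 𝑿) where

    displace-discontinuous : ∀ {x y} → x ≢ y → ¬ Continuous 𝑿 𝑿 (displace x y)
    displace-discontinuous {x} {y} x≢y cont with fpp (displace x y) cont
    ... | z , fixed = displace-fixes-none x≢y z fixed

    fpp⇒edgeless : ∀ x y → ¬ κ x y
    fpp⇒edgeless x y xκy = displace-discontinuous (λ x≡y → κ-irrefl x≡y xκy)
      (two-valued⇒continuous xκy (displace x y) (displace-values x y))

    fpp⇒all-equal : ∀ x y → x ≡ y
    fpp⇒all-equal x y = decidable-stable (x ≟ y) λ x≢y →
      displace-discontinuous x≢y (edgeless⇒continuous fpp⇒edgeless (displace x y))

    fpp⇒singleton : HasCardinality 𝑿 1
    -- With `nonempty` as the image of `zero`, the second inverse law says that every point equals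
    -- `nonempty`.
    fpp⇒singleton = mk↔ₛ′ (λ _ → zero) (λ _ → nonempty)
      (λ { zero → refl }) (fpp⇒all-equal nonempty)

  singleton⇒fpp : HasCardinality 𝑿 1 → FixedPointProperty 𝑿
  singleton⇒fpp X↔1 f _ = nonempty , all-equal (f nonempty) nonempty
    where
    open Inverse X↔1 using (to; from; strictlyInverseʳ)
    Fin1-trivial : (i j : Fin 1) → i ≡ j
    Fin1-trivial zero zero = refl
    all-equal : ∀ x y → x ≡ y
    all-equal x y = trans (sym (strictlyInverseʳ x))
      (trans (cong from (Fin1-trivial (to x) (to y))) (strictlyInverseʳ y))

theorem3p1 : (𝑿 : DigitalImage) → FixedPointProperty 𝑿 ⇔ HasCardinality 𝑿 1
theorem3p1 𝑿 = mk⇔ (fpp⇒singleton 𝑿) (singleton⇒fpp 𝑿)
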